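{- Let $k\ge 2$ and $1\le d\le k-1$ be integers, and put $t=k-d$. Then \[ h_d(k,n) \ge \Bigg( 1 - \binom t{ \lfloor t/2 \rfloor} \frac{ \lceil t/2\rceil^{\lceil t/2\rceil} (\lfloor t/2 \rfloor+1) ^{\lfloor t/2 \rfloor}}{(t+1)^t} +o(1) \Bigg) \binom nt, \] where $o(1)$ denotes a quantity tending to $0$ as $n\to\infty$.
   Context: A $k$-uniform hypergraph ($k$-graph) $H$ consists of a vertex set $V$ and an edge set $E\subseteq\binom{V}{k}$. For a set $S$ of $d$ vertices ($1\le d\le k-1$), $\deg_H(S)$ is the number of edges containing $S$, and the minimum $d$-degree $\delta_d(H)$ is the minimum of $\deg_H(S)$ over all $d$-vertex sets $S$. For $1\le \ell\le k-1$, a $k$-graph is an $\ell$-cycle if its vertices can be ordered cyclically so that each edge consists of $k$ consecutive vertices and every two consecutive edges (in the natural order of the edges) share exactly $\ell$ vertices. A Hamilton $\ell$-cycle of $H$ is a spanning subhypergraph that is an $\ell$-cycle. For $n$ divisible by $k-\ell$, $h_d^\ell(k,n)$ is the smallest integer $h$ such that every $n$-vertex $k$-graph $H$ with $\delta_d(H)\ge h$ contains a Hamilton $\ell$-cycle; $h_d(k,n)$ denotes $h_d^{k-1}(k,n)$ (the tight Hamilton cycle threshold). -}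

module Defs where

open import Data.Nat using (ℕ; zero; suc; _+_; _*_; _∸_; _^_; _≤_; ⌊_/2⌋; ⌈_/2⌉; NonZero)
open import Data.Nat.Properties using (m^n≢0)
open import Data.Nat.DivMod using (_mod_)
open import Data.Nat.Combinatorics using (_C_)
open import Data.Bool using (Bool; true; false; _∧_; _∨_; not)
open import Data.Fin using (Fin; toℕ)
open import Data.Fin.Subset using (Subset; ∣_∣; ⁅_⁆; _∪_) renaming (⊥ to ∅)
open import Data.Vec using (Vec; []; _∷_)
open import Data.List using (List; []; _∷_; map; _++_; length; filter; foldr; upTo)
open import Data.Product using (Σ; _×_)
open import Data.Unit using (⊤)
open import Data.Integer using (+_)
open import Data.Rational using (ℚ; 1ℚ; _-_) renaming (_/_ to _/ℚ_)
open import Function.Definitions using (Injective)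
open import Relation.Binary.PropositionalEquality using (_≡_)

record KGraph (k n : ℕ) : Set where
  field
    edge    : Subset n → Bool
    uniform : ∀ e → edge e ≡ true → ∣ e ∣ ≡ k
open KGraph public

allSubsets : (n : ℕ) → List (Subset n)
allSubsets zero    = [] ∷ []
allSubsets (suc n) = map (true ∷_) (allSubsets n) ++ map (false ∷_) (allSubsets n)

_⊆ᵇ_ : ∀ {n} → Subset n → Subset n → Bool
[] ⊆ᵇ [] = true
(x ∷ xs) ⊆ᵇ (y ∷ ys) = (not x ∨ y) ∧ (xs ⊆ᵇ ys)

deg : ∀ {k n} → KGraph k n → Subset n → ℕ
deg H S = length (filter (λ e → Data.Bool.T? (edge H e ∧ (S ⊆ᵇ e))) (allSubsets _))
  where import Data.Bool

MinDegGeq : ∀ {k n} → (d : ℕ) → KGraph k n → ℕ → Set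
MinDegGeq {n = n} d H h = ∀ (S : Subset n) → ∣ S ∣ ≡ d → h ≤ deg H S

window : ∀ {n} .{{_ : NonZero n}} → (k : ℕ) → (Fin n → Fin n) → Fin n → Subset n
window {n} k σ i = foldr (λ j S → ⁅ σ ((toℕ i + j) mod n) ⁆ ∪ S) ∅ (upTo k)

HasHamTightCycle : ∀ {k n} → KGraph k n → Set
HasHamTightCycle {k} {zero}  H = ⊤
HasHamTightCycle {k} {suc m} H =
  Σ (Fin (suc m) → Fin (suc m)) λ σ →
    Injective _≡_ _≡_ σ × (∀ i → edge H (window k σ i) ≡ true)

HamProp : (d k n h : ℕ) → Set
HamProp d k n h = ∀ (H : KGraph k n) → MinDegGeq d H h → HasHamTightCycle H

IsHd : (d k n h : ℕ) → Set
IsHd d k n h = HamProp d k n h × (∀ h' → HamProp d k n h' → h ≤ h')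

constC : ℕ → ℚ
constC t = 1ℚ - ((+ ((t C ⌊ t /2⌋) * (⌈ t /2⌉ ^ ⌈ t /2⌉) * ((⌊ t /2⌋ + 1) ^ ⌊ t /2⌋)))
                  /ℚ ((suc t) ^ t)) {{m^n≢0 (suc t) t}}

ℕtoℚ : ℕ → ℚ
ℕtoℚ m = (+ m) /ℚ 1

{-# OPTIONS --safe #-}
module Submission where

-- Fix a set A of about c n / (t + 1) vertices, c = ⌈t/2⌉, and let the edges be all k-sets that do
-- not meet A in exactly j = ⌊k c / (t + 1)⌋ vertices.  Along a tight cycle |e ∩ A| changes by at
-- most one from an edge to the next, so it stays below j or stays above j, whereas its average over
-- a Hamilton cycle is k |A| / n, which lies strictly between j - 1 and j + 1.  The t-sets that do
-- not extend a given d-set to an edge have a prescribed number i of vertices in A; their density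
-- is asymptotically at most the probability that a binomial variable with t trials and success probability
-- c / (t + 1) equals i, and this is largest at the mode i = c.

open import Defs

-- Binomial coefficients, factorials and the mode of a binomial distribution.

module Binomials where

  open import Data.Nat
  open import Data.Nat.Properties
  open import Data.Nat.Combinatorics
  open import Data.Nat.Tactic.RingSolver using (solve-∀)
  open import Data.Product using (_,_)
  open import Data.Sum using (inj₁; inj₂)
  open import Algebra.Properties.CommutativeSemigroup *-commutativeSemigroup using (x∙yz≈y∙xz)
  open import Relation.Binary.PropositionalEquality

  -- The absorption identity, kept in product form so that no division occurs; it follows from
  -- Pascal's rule by induction on `n`.
  [n+1]C[k+1]*[k+1] : ∀ n k → (suc n C suc k) * suc k ≡ suc n * (n C k)
  [n+1]C[k+1]*[k+1] n zero = cong (_* 1) (nC1≡n (suc n))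
  [n+1]C[k+1]*[k+1] zero (suc k) = refl
  [n+1]C[k+1]*[k+1] (suc n) (suc k) = begin-equality
    (suc (suc n) C suc (suc k)) * suc (suc k)
      ≡⟨ cong (_* suc (suc k)) (nCk+nC[k+1]≡[n+1]C[k+1] (suc n) (suc k)) ⟨
    (x + y) * suc (suc k)
      ≡⟨ split x y (suc k) ⟩
    x + (x * suc k + y * suc (suc k))
      ≡⟨ cong (x +_) (cong₂ _+_ ([n+1]C[k+1]*[k+1] n k) ([n+1]C[k+1]*[k+1] n (suc k))) ⟩
    x + (suc n * (n C k) + suc n * (n C suc k))
      ≡⟨ cong (x +_) (*-distribˡ-+ (suc n) (n C k) (n C suc k)) ⟨
    x + suc n * (n C k + n C suc k)
      ≡⟨ cong (λ z → x + suc n * z) (nCk+nC[k+1]≡[n+1]C[k+1] n k) ⟩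
    suc (suc n) * (suc n C suc k) ∎
    where
    open ≤-Reasoning
    x = suc n C suc k
    y = suc n C suc (suc k)
    split : ∀ x y k → (x + y) * suc k ≡ x + (x * k + y * suc k)
    split = solve-∀

  [n+1]C[k+1]*[k+1]! : ∀ n k → (suc n C suc k) * suc k ! ≡ suc n * ((n C k) * k !)
  [n+1]C[k+1]*[k+1]! n k = begin
    (suc n C suc k) * (suc k * k !)  ≡⟨ *-assoc (suc n C suc k) (suc k) (k !) ⟨
    (suc n C suc k) * suc k * k !    ≡⟨ cong (_* k !) ([n+1]C[k+1]*[k+1] n k) ⟩
    suc n * (n C k) * k !            ≡⟨ *-assoc (suc n) (n C k) (k !) ⟩
    suc n * ((n C k) * k !)          ∎
    where open ≡-Reasoning

  nCk*k!≤n^k : ∀ n k → (n C k) * k ! ≤ n ^ k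
  nCk*k!≤n^k n       zero    = ≤-refl
  nCk*k!≤n^k zero    (suc k) = z≤n
  nCk*k!≤n^k (suc n) (suc k) = begin
    (suc n C suc k) * suc k !  ≡⟨ [n+1]C[k+1]*[k+1]! n k ⟩
    suc n * ((n C k) * k !)    ≤⟨ *-monoʳ-≤ (suc n) (nCk*k!≤n^k n k) ⟩
    suc n * n ^ k            ≤⟨ *-monoʳ-≤ (suc n) (^-monoˡ-≤ k (n≤1+n n)) ⟩
    suc n * suc n ^ k        ∎
    where open ≤-Reasoning

  -- The right side is the product of `m + 1`, ..., `m + t`, each factor being at least `m`. With
  -- `nCk*k!≤n^k` it squeezes binomial coefficients between powers.
  m^t≤[m+t]Ct*t! : ∀ m t → m ^ t ≤ ((m + t) C t) * t !
  m^t≤[m+t]Ct*t! m zero    = ≤-refl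
  m^t≤[m+t]Ct*t! m (suc t) = begin
    m * m ^ t                          ≤⟨ *-mono-≤ (m≤n⇒m≤1+n (m≤m+n m t)) (m^t≤[m+t]Ct*t! m t) ⟩
    suc (m + t) * (((m + t) C t) * t !)  ≡⟨ [n+1]C[k+1]*[k+1]! (m + t) t ⟨
    (suc (m + t) C suc t) * suc t !      ≡⟨ cong (λ z → (z C suc t) * suc t !) (+-suc m t) ⟨
    ((m + suc t) C suc t) * suc t !      ∎
    where open ≤-Reasoning

  nCk≤[n+1]Ck : ∀ n k → n C k ≤ suc n C k
  nCk≤[n+1]Ck n zero    = ≤-refl
  nCk≤[n+1]Ck n (suc k) =
    subst (n C suc k ≤_) (nCk+nC[k+1]≡[n+1]C[k+1] n k) (m≤n+m (n C suc k) (n C k))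

  C-monoˡ-≤ : ∀ k {m n} → m ≤ n → m C k ≤ n C k
  C-monoˡ-≤ k m≤n = go (≤⇒≤′ m≤n)
    where
    go : ∀ {m n} → m ≤′ n → m C k ≤ n C k
    go ≤′-refl        = ≤-refl
    go (≤′-step m≤′n) = ≤-trans (go m≤′n) (nCk≤[n+1]Ck _ k)

  [k+l]Ck*k!*l!≡[k+l]! : ∀ k l → ((k + l) C k) * (k ! * l !) ≡ (k + l) !
  [k+l]Ck*k!*l!≡[k+l]! zero    l = trans (*-identityˡ _) (*-identityˡ (l !))
  [k+l]Ck*k!*l!≡[k+l]! (suc k) l = begin
    (suc (k + l) C suc k) * (suc k ! * l !)  ≡⟨ *-assoc (suc (k + l) C suc k) (suc k !) (l !) ⟨
    (suc (k + l) C suc k) * suc k ! * l !    ≡⟨ cong (_* l !) ([n+1]C[k+1]*[k+1]! (k + l) k) ⟩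
    suc (k + l) * (((k + l) C k) * k !) * l !
      ≡⟨ reassoc (suc (k + l)) ((k + l) C k) (k !) (l !) ⟩
    suc (k + l) * (((k + l) C k) * (k ! * l !)) ≡⟨ cong (suc (k + l) *_) ([k+l]Ck*k!*l!≡[k+l]! k l) ⟩
    suc (k + l) * (k + l) ! ∎
    where
    open ≡-Reasoning
    reassoc : ∀ a b c d → a * (b * c) * d ≡ a * (b * (c * d))
    reassoc = solve-∀

  m!*[m+1]^s≤[m+s]! : ∀ m s → m ! * suc m ^ s ≤ (m + s) !
  m!*[m+1]^s≤[m+s]! m zero = ≤-reflexive (trans (*-identityʳ (m !)) (cong _! (sym (+-identityʳ m))))
  m!*[m+1]^s≤[m+s]! m (suc s) = begin
    m ! * (suc m * suc m ^ s)  ≡⟨ x∙yz≈y∙xz (m !) (suc m) (suc m ^ s) ⟩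
    suc m * (m ! * suc m ^ s)  ≤⟨ *-mono-≤ (s≤s (m≤m+n m s)) (m!*[m+1]^s≤[m+s]! m s) ⟩
    suc (m + s) * (m + s) !    ≡⟨ cong _! (+-suc m s) ⟨
    (m + suc s) !              ∎
    where
    open ≤-Reasoning

  [m+s]!≤m!*b^s : ∀ m s {b} → m + s ≤ b → (m + s) ! ≤ m ! * b ^ s
  [m+s]!≤m!*b^s m zero    _ = ≤-reflexive (trans (cong _! (+-identityʳ m)) (sym (*-identityʳ (m !))))
  [m+s]!≤m!*b^s m (suc s) {b} m+s<b = begin
    (m + suc s) !            ≡⟨ cong _! (+-suc m s) ⟩
    suc (m + s) * (m + s) !  ≤⟨ *-mono-≤ 1+m+s≤b ([m+s]!≤m!*b^s m s (<⇒≤ 1+m+s≤b)) ⟩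
    b * (m ! * b ^ s)        ≡⟨ x∙yz≈y∙xz b (m !) (b ^ s) ⟩
    m ! * (b * b ^ s)        ∎
    where
    open ≤-Reasoning
    1+m+s≤b : suc (m + s) ≤ b
    1+m+s≤b = subst (_≤ b) (+-suc m s) m+s<b

  -- With p = c / (c + f + 1), this says that the binomial distribution on c + f trials with success
  -- probability p has its mode at c.
  binomial-mode : ∀ c f i l → i + l ≡ c + f →
    c ! * f ! * (c ^ i * suc f ^ l) ≤ i ! * l ! * (c ^ c * suc f ^ f)
  binomial-mode c f i l i+l≡c+f with ≤-total c i
  ... | inj₁ c≤i with m≤n⇒∃[o]m+o≡n c≤i
  -- Here `i = c + s` and `f = l + s`: the `s` factors of `f ! / l !` are at most `g`, while those
  -- of `i ! / c !` exceed `c`.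
  ...   | s , refl = begin
    c ! * f ! * (c ^ (c + s) * g ^ l)
      ≡⟨ cong₂ (λ y z → c ! * y ! * (z * g ^ l)) f≡l+s (^-distribˡ-+-* c c s) ⟩
    c ! * (l + s) ! * (c ^ c * c ^ s * g ^ l)
      ≤⟨ *-monoˡ-≤ _ (*-monoʳ-≤ (c !) ([m+s]!≤m!*b^s l s (subst (_≤ g) f≡l+s (n≤1+n f)))) ⟩
    c ! * (l ! * g ^ s) * (c ^ c * c ^ s * g ^ l)
      ≡⟨ rearrange (c !) (l !) (g ^ s) (c ^ c) (c ^ s) (g ^ l) ⟩
    c ! * c ^ s * (l ! * (c ^ c * (g ^ l * g ^ s)))
      ≤⟨ *-monoˡ-≤ _ (≤-trans (*-monoʳ-≤ (c !) (^-monoˡ-≤ s (n≤1+n c))) (m!*[m+1]^s≤[m+s]! c s)) ⟩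
    (c + s) ! * (l ! * (c ^ c * (g ^ l * g ^ s)))
      ≡⟨ cong (λ z → (c + s) ! * (l ! * (c ^ c * z)))
           (trans (sym (^-distribˡ-+-* g l s)) (cong (g ^_) (sym f≡l+s))) ⟩
    (c + s) ! * (l ! * (c ^ c * g ^ f))
      ≡⟨ *-assoc ((c + s) !) (l !) _ ⟨
    (c + s) ! * l ! * (c ^ c * g ^ f) ∎
    where
    open ≤-Reasoning
    g = suc f
    f≡l+s : f ≡ l + s
    f≡l+s = +-cancelˡ-≡ c f (l + s) (trans (sym i+l≡c+f) (trans (+-assoc c s l) (cong (c +_) (+-comm s l))))
    rearrange : ∀ a b x y z w → a * (b * x) * (y * z * w) ≡ a * z * (b * (y * (w * x)))
    rearrange = solve-∀
  binomial-mode c f i l i+l≡c+f | inj₂ i≤c with m≤n⇒∃[o]m+o≡n i≤c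
  -- Here `c = i + s` and `l = f + s`: the `s` factors of `c ! / i !` are at most `c`, while those
  -- of `l ! / f !` are at least `g = f + 1`.
  ...   | s , refl = begin
    (i + s) ! * f ! * ((i + s) ^ i * g ^ l)
      ≡⟨ cong (λ z → (i + s) ! * f ! * ((i + s) ^ i * z))
           (trans (cong (g ^_) l≡f+s) (^-distribˡ-+-* g f s)) ⟩
    (i + s) ! * f ! * ((i + s) ^ i * (g ^ f * g ^ s))
      ≤⟨ *-monoˡ-≤ _ (*-monoˡ-≤ (f !) ([m+s]!≤m!*b^s i s ≤-refl)) ⟩
    i ! * (i + s) ^ s * f ! * ((i + s) ^ i * (g ^ f * g ^ s))
      ≡⟨ rearrange (i !) ((i + s) ^ s) (f !) ((i + s) ^ i) (g ^ f) (g ^ s) ⟩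
    f ! * g ^ s * (i ! * ((i + s) ^ i * (i + s) ^ s * g ^ f))
      ≤⟨ *-monoˡ-≤ _ (m!*[m+1]^s≤[m+s]! f s) ⟩
    (f + s) ! * (i ! * ((i + s) ^ i * (i + s) ^ s * g ^ f))
      ≡⟨ cong₂ (λ y z → y ! * (i ! * (z * g ^ f))) (sym l≡f+s) (sym (^-distribˡ-+-* (i + s) i s)) ⟩
    l ! * (i ! * ((i + s) ^ (i + s) * g ^ f))
      ≡⟨ swap (l !) (i !) _ ⟩
    i ! * l ! * ((i + s) ^ (i + s) * g ^ f) ∎
    where
    open ≤-Reasoning
    g = suc f
    l≡f+s : l ≡ f + s
    l≡f+s = +-cancelˡ-≡ i l (f + s) (trans i+l≡c+f (trans (+-assoc i s f) (cong (i +_) (+-comm s f))))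
    rearrange : ∀ a b x y z w → a * b * x * (y * (z * w)) ≡ x * w * (a * (y * b * z))
    rearrange = solve-∀
    swap : ∀ a b c → a * (b * c) ≡ b * a * c
    swap = solve-∀

  -- This is `(1 + r) ^ t - 1`, a constant `R` with `(1 + r / m) ^ t ≤ 1 + R / m` for every positive
  -- `m`.
  growthConst : ℕ → ℕ → ℕ
  growthConst r zero    = 0
  growthConst r (suc t) = let R = growthConst r t in r + R + r * R

  [m+r]^t*m≤m^t*[m+R] : ∀ r t m → .{{NonZero m}} → (m + r) ^ t * m ≤ m ^ t * (m + growthConst r t)
  [m+r]^t*m≤m^t*[m+R] r zero    m = ≤-reflexive (cong (1 *_) (sym (+-identityʳ m)))
  [m+r]^t*m≤m^t*[m+R] r (suc t) m = begin
    (m + r) * (m + r) ^ t * m          ≡⟨ *-assoc (m + r) _ m ⟩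
    (m + r) * ((m + r) ^ t * m)        ≤⟨ *-monoʳ-≤ (m + r) ([m+r]^t*m≤m^t*[m+R] r t m) ⟩
    (m + r) * (m ^ t * (m + R))        ≡⟨ expand m r R (m ^ t) ⟩
    -- The cross term gains a factor `m ≥ 1`, so that a factor `m` can be taken out of the whole
    -- sum.
    m ^ t * (m * (m + (r + R)) + r * R * 1) ≤⟨ *-monoʳ-≤ (m ^ t) (+-monoʳ-≤ _ (*-monoʳ-≤ (r * R) (>-nonZero⁻¹ m))) ⟩
    m ^ t * (m * (m + (r + R)) + r * R * m) ≡⟨ collect m r R (m ^ t) ⟩
    m * m ^ t * (m + (r + R + r * R))  ∎
    where
    open ≤-Reasoning
    R = growthConst r t
    expand : ∀ m r R x → (m + r) * (x * (m + R)) ≡ x * (m * (m + (r + R)) + r * R * 1)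
    expand = solve-∀
    collect : ∀ m r R x → x * (m * (m + (r + R)) + r * R * m) ≡ m * x * (m + (r + R + r * R))
    collect = solve-∀

  -- The source of the `o(1)`: once `m` is at least `E * R`, the shift by `r` costs at most a factor
  -- `1 + 1 / E`.
  E*[m+r]^t≤[E+1]*m^t : ∀ E r t m → .{{NonZero m}} → E * growthConst r t ≤ m →
    E * (m + r) ^ t ≤ suc E * m ^ t
  E*[m+r]^t≤[E+1]*m^t E r t m E*R≤m = *-cancelʳ-≤ _ _ m (begin
    E * (m + r) ^ t * m    ≡⟨ *-assoc E _ m ⟩
    E * ((m + r) ^ t * m)  ≤⟨ *-monoʳ-≤ E ([m+r]^t*m≤m^t*[m+R] r t m) ⟩
    E * (m ^ t * (m + R))  ≡⟨ expand E m R (m ^ t) ⟩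
    m ^ t * (E * m + E * R) ≤⟨ *-monoʳ-≤ (m ^ t) (+-monoʳ-≤ (E * m) E*R≤m) ⟩
    m ^ t * (E * m + m)    ≡⟨ collect E m (m ^ t) ⟩
    suc E * m ^ t * m      ∎)
    where
    open ≤-Reasoning
    R = growthConst r t
    expand : ∀ E m R x → E * (x * (m + R)) ≡ x * (E * m + E * R)
    expand = solve-∀
    collect : ∀ E m x → x * (E * m + m) ≡ suc E * x * m
    collect = solve-∀

-- Counting the extensions of a vertex set and bounding degrees.

module Counting where

  open Binomials
  open import Data.Nat
  open import Data.Nat.Properties
  open import Data.Nat.Combinatorics
  open import Data.Bool using (Bool; true; false; _∧_; not; T; T?)
  open import Data.Bool.Properties using (∧-zeroʳ; T-∧; T-≡)
  open import Data.Fin.Subset using (Subset; ∣_∣; _∩_; ∁)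
  open import Data.Vec using ([]; _∷_)
  open import Data.List using ([]; _∷_; _++_; length; filter; map)
  open import Data.List.Properties using (filter-++; length-++)
  open import Data.Nat.Tactic.RingSolver using (solve-∀)
  open import Data.Product using (_×_; _,_; ∃₂; proj₁)
  open import Data.Sum using (_⊎_; inj₁; inj₂)
  open import Data.Unit using (tt)
  open import Function using (_∘_; Equivalence)
  open import Relation.Binary.PropositionalEquality

  private variable
    n : ℕ

  -- Chosen so that `deg H S` is an instance by definition, with the predicate
  -- `edge H e ∧ (S ⊆ᵇ e)`.
  count : (Subset n → Bool) → ℕ
  count p = length (filter (λ e → T? (p e)) (allSubsets _))

  length-filter-map : ∀ {A B : Set} (p : B → Bool) (f : A → B) xs →
    length (filter (λ y → T? (p y)) (map f xs)) ≡ length (filter (λ x → T? (p (f x))) xs)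
  length-filter-map p f []       = refl
  length-filter-map p f (x ∷ xs) with p (f x)
  ... | true  = cong suc (length-filter-map p f xs)
  ... | false = length-filter-map p f xs

  count-∷ : (p : Subset (suc n) → Bool) → count p ≡ count (p ∘ (true ∷_)) + count (p ∘ (false ∷_))
  count-∷ {n} p = begin
    count p
      ≡⟨ cong length (filter-++ p? (map (true ∷_) (allSubsets n)) _) ⟩
    length (filter p? (map (true ∷_) (allSubsets n)) ++ filter p? (map (false ∷_) (allSubsets n)))
      ≡⟨ length-++ (filter p? (map (true ∷_) (allSubsets n))) ⟩
    length (filter p? (map (true ∷_) (allSubsets n))) + length (filter p? (map (false ∷_) (allSubsets n)))
      ≡⟨ cong₂ _+_ (length-filter-map p (true ∷_) (allSubsets n)) (length-filter-map p (false ∷_) (allSubsets n)) ⟩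
    count (p ∘ (true ∷_)) + count (p ∘ (false ∷_)) ∎
    where
    open ≡-Reasoning
    p? = λ e → T? (p e)

  count-none : (p : Subset n → Bool) → (∀ e → p e ≡ false) → count p ≡ 0
  count-none {zero}  p none rewrite none [] = refl
  count-none {suc n} p none = trans (count-∷ p)
    (cong₂ _+_ (count-none (p ∘ (true ∷_)) (none ∘ (true ∷_))) (count-none (p ∘ (false ∷_)) (none ∘ (false ∷_))))

  count-cover : (p q r : Subset n → Bool) → (∀ e → T (p e) → T (q e) ⊎ T (r e)) →
    count p ≤ count q + count r
  count-cover {zero} p q r cover with p [] | q [] | r [] | cover []
  ... | false | _     | _     | _ = z≤n
  ... | true  | true  | _     | _ = s≤s z≤n
  ... | true  | false | true  | _ = ≤-refl
  ... | true  | false | false | f with f tt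
  ...   | inj₁ ()
  ...   | inj₂ ()
  count-cover {suc n} p q r cover = begin
    count p                    ≡⟨ count-∷ p ⟩
    count (p ∘ (true ∷_)) + count (p ∘ (false ∷_))
      ≤⟨ +-mono-≤ (half true) (half false) ⟩
    count (q ∘ (true ∷_)) + count (r ∘ (true ∷_)) + (count (q ∘ (false ∷_)) + count (r ∘ (false ∷_)))
      ≡⟨ interchange (count (q ∘ (true ∷_))) _ _ _ ⟩
    count (q ∘ (true ∷_)) + count (q ∘ (false ∷_)) + (count (r ∘ (true ∷_)) + count (r ∘ (false ∷_)))
      ≡⟨ cong₂ _+_ (count-∷ q) (count-∷ r) ⟨
    count q + count r          ∎
    where
    open ≤-Reasoning
    half : ∀ b → count (p ∘ (b ∷_)) ≤ count (q ∘ (b ∷_)) + count (r ∘ (b ∷_))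
    half b = count-cover (p ∘ (b ∷_)) (q ∘ (b ∷_)) (r ∘ (b ∷_)) (cover ∘ (b ∷_))
    interchange : ∀ a b c d → a + b + (c + d) ≡ a + c + (b + d)
    interchange = solve-∀

  -- Sets e ⊇ S are counted by their new vertices e ∩ ∁ S, so that the inductions below need no
  -- truncated subtraction of ∣ S ∣.

  extends : Subset n → ℕ → Subset n → Bool
  extends S t e = (S ⊆ᵇ e) ∧ (∣ e ∩ ∁ S ∣ ≡ᵇ t)

  extendsIn : Subset n → Subset n → ℕ → ℕ → Subset n → Bool
  extendsIn A S i l e = (S ⊆ᵇ e) ∧ ((∣ (e ∩ ∁ S) ∩ A ∣ ≡ᵇ i) ∧ (∣ (e ∩ ∁ S) ∩ ∁ A ∣ ≡ᵇ l))

  count-extends : (S : Subset n) (t : ℕ) → count (extends S t) ≡ ∣ ∁ S ∣ C t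
  count-extends [] zero    = refl
  count-extends [] (suc t) = refl
  count-extends {suc n} (true ∷ S) t = begin
    count (extends (true ∷ S) t)           ≡⟨ count-∷ (extends (true ∷ S) t) ⟩
    count (extends S t) + count {n} (λ _ → false)
      ≡⟨ cong (count (extends S t) +_) (count-none {n} (λ _ → false) (λ _ → refl)) ⟩
    count (extends S t) + 0                ≡⟨ +-identityʳ _ ⟩
    count (extends S t)                    ≡⟨ count-extends S t ⟩
    ∣ ∁ S ∣ C t                            ∎
    where open ≡-Reasoning
  count-extends (false ∷ S) zero = begin
    count (extends (false ∷ S) zero)  ≡⟨ count-∷ (extends (false ∷ S) zero) ⟩
    count (λ e → (S ⊆ᵇ e) ∧ false) + count (extends S zero)
      ≡⟨ cong₂ _+_ (count-none _ (λ e → ∧-zeroʳ (S ⊆ᵇ e))) (count-extends S zero) ⟩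
    1                                      ∎
    where open ≡-Reasoning
  count-extends (false ∷ S) (suc t) = begin
    count (extends (false ∷ S) (suc t))    ≡⟨ count-∷ (extends (false ∷ S) (suc t)) ⟩
    count (extends S t) + count (extends S (suc t))
      ≡⟨ cong₂ _+_ (count-extends S t) (count-extends S (suc t)) ⟩
    ∣ ∁ S ∣ C t + ∣ ∁ S ∣ C suc t          ≡⟨ nCk+nC[k+1]≡[n+1]C[k+1] ∣ ∁ S ∣ t ⟩
    suc ∣ ∁ S ∣ C suc t                    ∎
    where open ≡-Reasoning

  -- Only an upper bound: the new vertices avoid `S`, whereas the right side lets them range over
  -- all of `A` and `∁ A`. The loss is of lower order.
  count-extendsIn : (A S : Subset n) (i l : ℕ) →
    count (extendsIn A S i l) ≤ (∣ A ∣ C i) * (∣ ∁ A ∣ C l)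
  count-extendsIn [] [] zero    zero    = ≤-refl
  count-extendsIn [] [] zero    (suc l) = z≤n
  count-extendsIn [] [] (suc i) l       = z≤n
  count-extendsIn {suc n} (a ∷ A) (true ∷ S) i l = begin
    count (extendsIn (a ∷ A) (true ∷ S) i l)       ≡⟨ count-∷ (extendsIn (a ∷ A) (true ∷ S) i l) ⟩
    count (λ e → extendsIn (a ∷ A) (true ∷ S) i l (true ∷ e)) + count {n} (λ _ → false)
      ≡⟨ cong₂ _+_ (new a) (count-none {n} (λ _ → false) (λ _ → refl)) ⟩
    count (extendsIn A S i l) + 0                  ≡⟨ +-identityʳ _ ⟩
    count (extendsIn A S i l)                      ≤⟨ count-extendsIn A S i l ⟩
    (∣ A ∣ C i) * (∣ ∁ A ∣ C l)                    ≤⟨ grow a ⟩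
    (∣ a ∷ A ∣ C i) * (∣ ∁ (a ∷ A) ∣ C l)          ∎
    where
    open ≤-Reasoning
    new : ∀ a → count (λ e → extendsIn (a ∷ A) (true ∷ S) i l (true ∷ e)) ≡ count (extendsIn A S i l)
    new true  = refl
    new false = refl
    grow : ∀ a → (∣ A ∣ C i) * (∣ ∁ A ∣ C l) ≤ (∣ a ∷ A ∣ C i) * (∣ ∁ (a ∷ A) ∣ C l)
    grow true  = *-monoˡ-≤ _ (nCk≤[n+1]Ck ∣ A ∣ i)
    grow false = *-monoʳ-≤ (∣ A ∣ C i) (nCk≤[n+1]Ck ∣ ∁ A ∣ l)
  count-extendsIn (true ∷ A) (false ∷ S) zero l = begin
    count (extendsIn (true ∷ A) (false ∷ S) zero l)  ≡⟨ count-∷ (extendsIn (true ∷ A) (false ∷ S) zero l) ⟩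
    count (λ e → (S ⊆ᵇ e) ∧ false) + count (extendsIn A S zero l)
      ≡⟨ cong (_+ count (extendsIn A S zero l)) (count-none _ (λ e → ∧-zeroʳ (S ⊆ᵇ e))) ⟩
    count (extendsIn A S zero l)                     ≤⟨ count-extendsIn A S zero l ⟩
    1 * (∣ ∁ A ∣ C l)                                ∎
    where open ≤-Reasoning
  count-extendsIn (true ∷ A) (false ∷ S) (suc i) l = begin
    count (extendsIn (true ∷ A) (false ∷ S) (suc i) l)
      ≡⟨ count-∷ (extendsIn (true ∷ A) (false ∷ S) (suc i) l) ⟩
    count (extendsIn A S i l) + count (extendsIn A S (suc i) l)
      ≤⟨ +-mono-≤ (count-extendsIn A S i l) (count-extendsIn A S (suc i) l) ⟩
    (∣ A ∣ C i) * (∣ ∁ A ∣ C l) + (∣ A ∣ C suc i) * (∣ ∁ A ∣ C l)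
      ≡⟨ *-distribʳ-+ (∣ ∁ A ∣ C l) (∣ A ∣ C i) (∣ A ∣ C suc i) ⟨
    (∣ A ∣ C i + ∣ A ∣ C suc i) * (∣ ∁ A ∣ C l)
      ≡⟨ cong (_* (∣ ∁ A ∣ C l)) (nCk+nC[k+1]≡[n+1]C[k+1] ∣ A ∣ i) ⟩
    (suc ∣ A ∣ C suc i) * (∣ ∁ A ∣ C l) ∎
    where open ≤-Reasoning
  count-extendsIn (false ∷ A) (false ∷ S) i zero = begin
    count (extendsIn (false ∷ A) (false ∷ S) i zero)  ≡⟨ count-∷ (extendsIn (false ∷ A) (false ∷ S) i zero) ⟩
    count (λ e → (S ⊆ᵇ e) ∧ ((∣ (e ∩ ∁ S) ∩ A ∣ ≡ᵇ i) ∧ false)) + count (extendsIn A S i zero)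
      ≡⟨ cong (_+ count (extendsIn A S i zero)) (count-none _ (λ e →
           trans (cong ((S ⊆ᵇ e) ∧_) (∧-zeroʳ (∣ (e ∩ ∁ S) ∩ A ∣ ≡ᵇ i))) (∧-zeroʳ (S ⊆ᵇ e)))) ⟩
    count (extendsIn A S i zero)                      ≤⟨ count-extendsIn A S i zero ⟩
    (∣ A ∣ C i) * 1                                   ∎
    where open ≤-Reasoning
  count-extendsIn (false ∷ A) (false ∷ S) i (suc l) = begin
    count (extendsIn (false ∷ A) (false ∷ S) i (suc l))
      ≡⟨ count-∷ (extendsIn (false ∷ A) (false ∷ S) i (suc l)) ⟩
    count (extendsIn A S i l) + count (extendsIn A S i (suc l))
      ≤⟨ +-mono-≤ (count-extendsIn A S i l) (count-extendsIn A S i (suc l)) ⟩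
    (∣ A ∣ C i) * (∣ ∁ A ∣ C l) + (∣ A ∣ C i) * (∣ ∁ A ∣ C suc l)
      ≡⟨ *-distribˡ-+ (∣ A ∣ C i) (∣ ∁ A ∣ C l) (∣ ∁ A ∣ C suc l) ⟨
    (∣ A ∣ C i) * (∣ ∁ A ∣ C l + ∣ ∁ A ∣ C suc l)
      ≡⟨ cong ((∣ A ∣ C i) *_) (nCk+nC[k+1]≡[n+1]C[k+1] ∣ ∁ A ∣ l) ⟩
    (∣ A ∣ C i) * (suc ∣ ∁ A ∣ C suc l) ∎
    where open ≤-Reasoning

  ∣p∩q∣+∣p∩∁q∣≡∣p∣ : (p q : Subset n) → ∣ p ∩ q ∣ + ∣ p ∩ ∁ q ∣ ≡ ∣ p ∣
  ∣p∩q∣+∣p∩∁q∣≡∣p∣ []          []          = refl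
  ∣p∩q∣+∣p∩∁q∣≡∣p∣ (false ∷ p) (_ ∷ q)     = ∣p∩q∣+∣p∩∁q∣≡∣p∣ p q
  ∣p∩q∣+∣p∩∁q∣≡∣p∣ (true ∷ p)  (true ∷ q)  = cong suc (∣p∩q∣+∣p∩∁q∣≡∣p∣ p q)
  ∣p∩q∣+∣p∩∁q∣≡∣p∣ (true ∷ p)  (false ∷ q) = trans (+-suc _ _) (cong suc (∣p∩q∣+∣p∩∁q∣≡∣p∣ p q))

  ∣S∣+∣e∩∁S∣≡∣e∣ : (S e : Subset n) → T (S ⊆ᵇ e) → ∣ S ∣ + ∣ e ∩ ∁ S ∣ ≡ ∣ e ∣
  ∣S∣+∣e∩∁S∣≡∣e∣ []          []          _   = refl
  ∣S∣+∣e∩∁S∣≡∣e∣ (true ∷ S)  (true ∷ e)  S⊆e = cong suc (∣S∣+∣e∩∁S∣≡∣e∣ S e S⊆e)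
  ∣S∣+∣e∩∁S∣≡∣e∣ (false ∷ S) (true ∷ e)  S⊆e = trans (+-suc _ _) (cong suc (∣S∣+∣e∩∁S∣≡∣e∣ S e S⊆e))
  ∣S∣+∣e∩∁S∣≡∣e∣ (false ∷ S) (false ∷ e) S⊆e = ∣S∣+∣e∩∁S∣≡∣e∣ S e S⊆e

  ∣S∩A∣+∣e∩∁S∩A∣≡∣e∩A∣ : (A S e : Subset n) → T (S ⊆ᵇ e) → ∣ S ∩ A ∣ + ∣ (e ∩ ∁ S) ∩ A ∣ ≡ ∣ e ∩ A ∣
  ∣S∩A∣+∣e∩∁S∩A∣≡∣e∩A∣ []          []          []          _   = refl
  ∣S∩A∣+∣e∩∁S∩A∣≡∣e∩A∣ (true ∷ A)  (true ∷ S)  (true ∷ e)  S⊆e = cong suc (∣S∩A∣+∣e∩∁S∩A∣≡∣e∩A∣ A S e S⊆e)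
  ∣S∩A∣+∣e∩∁S∩A∣≡∣e∩A∣ (false ∷ A) (true ∷ S)  (true ∷ e)  S⊆e = ∣S∩A∣+∣e∩∁S∩A∣≡∣e∩A∣ A S e S⊆e
  ∣S∩A∣+∣e∩∁S∩A∣≡∣e∩A∣ (true ∷ A)  (false ∷ S) (true ∷ e)  S⊆e =
    trans (+-suc _ _) (cong suc (∣S∩A∣+∣e∩∁S∩A∣≡∣e∩A∣ A S e S⊆e))
  ∣S∩A∣+∣e∩∁S∩A∣≡∣e∩A∣ (false ∷ A) (false ∷ S) (true ∷ e)  S⊆e = ∣S∩A∣+∣e∩∁S∩A∣≡∣e∩A∣ A S e S⊆e
  ∣S∩A∣+∣e∩∁S∩A∣≡∣e∩A∣ (_ ∷ A)     (false ∷ S) (false ∷ e) S⊆e = ∣S∩A∣+∣e∩∁S∩A∣≡∣e∩A∣ A S e S⊆e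

  avoiding : (k j : ℕ) → Subset n → KGraph k n
  avoiding k j A = record
    { edge    = λ e → (∣ e ∣ ≡ᵇ k) ∧ not (∣ e ∩ A ∣ ≡ᵇ j)
    ; uniform = λ e e∈H → ≡ᵇ⇒≡ ∣ e ∣ k (proj₁ (Equivalence.to T-∧ (Equivalence.from T-≡ e∈H)))
    }

  deg-avoiding : (d t j : ℕ) (A S : Subset n) → ∣ S ∣ ≡ d →
    ∃₂ λ i l → i + l ≡ t × ∣ ∁ S ∣ C t ≤ deg (avoiding (d + t) j A) S + (∣ A ∣ C i) * (∣ ∁ A ∣ C l)
  -- Truncating i at t is harmless: if j ∸ s is not the number of new vertices in A, then e is already
  -- an edge.
  deg-avoiding {n} d t j A S ∣S∣≡d = i , l , m+[n∸m]≡n (m⊓n≤n (j ∸ s) t) , (begin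
    ∣ ∁ S ∣ C t                                   ≡⟨ count-extends S t ⟨
    count (extends S t)                           ≤⟨ count-cover (extends S t) nbr (extendsIn A S i l) cover ⟩
    count nbr + count (extendsIn A S i l)         ≤⟨ +-monoʳ-≤ (count nbr) (count-extendsIn A S i l) ⟩
    count nbr + (∣ A ∣ C i) * (∣ ∁ A ∣ C l)       ∎)
    where
    open ≤-Reasoning
    H = avoiding (d + t) j A
    s = ∣ S ∩ A ∣
    i = (j ∸ s) ⊓ t
    l = t ∸ i
    nbr : Subset n → Bool
    nbr e = edge H e ∧ (S ⊆ᵇ e)
    -- An extension that is not an edge meets `A` in exactly `j` vertices, which forces how its `t`
    -- new vertices split between `A` and `∁ A`.
    cover : ∀ e → T (extends S t e) → T (nbr e) ⊎ T (extendsIn A S i l e)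
    cover e ext with Equivalence.to T-∧ ext
    ... | S⊆e , new with ∣ e ∩ A ∣ ≡ᵇ j in eq
    ...   | false = inj₁ (Equivalence.from T-∧
                      (Equivalence.from T-∧ (≡⇒≡ᵇ ∣ e ∣ (d + t) ∣e∣≡d+t , tt) , S⊆e))
      where
      ∣e∣≡d+t : ∣ e ∣ ≡ d + t
      ∣e∣≡d+t = trans (sym (∣S∣+∣e∩∁S∣≡∣e∣ S e S⊆e)) (cong₂ _+_ ∣S∣≡d (≡ᵇ⇒≡ _ t new))
    ...   | true  = inj₂ (Equivalence.from T-∧ (S⊆e , Equivalence.from T-∧
                      (≡⇒≡ᵇ newA i newA≡i , ≡⇒≡ᵇ newB l newB≡l)))
      where
      newA = ∣ (e ∩ ∁ S) ∩ A ∣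
      newB = ∣ (e ∩ ∁ S) ∩ ∁ A ∣
      newA+newB≡t : newA + newB ≡ t
      newA+newB≡t = trans (∣p∩q∣+∣p∩∁q∣≡∣p∣ (e ∩ ∁ S) A) (≡ᵇ⇒≡ _ t new)
      s+newA≡j : s + newA ≡ j
      s+newA≡j = trans (∣S∩A∣+∣e∩∁S∩A∣≡∣e∩A∣ A S e S⊆e) (≡ᵇ⇒≡ _ j (Equivalence.from T-≡ eq))
      j∸s≡newA : j ∸ s ≡ newA
      j∸s≡newA = trans (cong (_∸ s) (sym s+newA≡j)) (m+n∸m≡n s newA)
      newA≡i : newA ≡ i
      newA≡i = sym (trans (cong (_⊓ t) j∸s≡newA) (m≤n⇒m⊓n≡m (m+n≤o⇒m≤o newA (≤-reflexive newA+newB≡t))))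
      newB≡l : newB ≡ l
      newB≡l = trans (sym (m+n∸m≡n newA newB)) (cong₂ _∸_ newA+newB≡t newA≡i)

-- Tight Hamilton cycles and the averaging argument.

module TightCycles where

  open Counting
  open import Data.Nat
  open import Data.Nat.Properties
  open import Data.Nat.DivMod using (_mod_; [m+n]%n≡m%n; m<n⇒m%n≡m; m%n<n)
  open import Data.Bool using (true; false; T; if_then_else_)
  open import Data.Bool.Properties using (T-∧; T-≡; T-not-≡)
  open import Data.Empty using (⊥; ⊥-elim)
  open import Data.Fin using (Fin; zero; suc; toℕ; fromℕ<; punchOut)
  open import Data.Fin.Properties using (toℕ-injective; toℕ-fromℕ<; toℕ<n; any?; punchOut-injective; injective⇒≤) renaming (_≟_ to _≟F_)
  open import Data.Fin.Permutation using (Permutation; permutation)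
  open import Data.Fin.Subset using (Subset; ∣_∣; _∩_; _∪_; ∁; ⁅_⁆) renaming (⊥ to ∅)
  open import Data.Fin.Subset.Properties using (∪-identityˡ; ∩-zeroˡ; ∣⊥∣≡0)
  open import Data.Vec using ([]; _∷_; lookup)
  open import Data.List using (foldr; applyUpTo)
  open import Data.Product using (_,_; ∃; proj₁; proj₂)
  open import Function using (_∘_; Equivalence; id)
  open import Function.Definitions using (Injective)
  open import Relation.Nullary using (¬_; yes; no)
  open import Relation.Binary.Definitions using (tri<; tri≈; tri>)
  open import Relation.Binary.PropositionalEquality
  open import Algebra.Properties.CommutativeMonoid.Sum +-0-commutativeMonoid using (sum; sum-syntax; sum-cong-≗; ∑-distrib-+; ∑-comm; sum-permute)

  private variable
    n : ℕ

  sum-const : ∀ n c → ∑[ i < n ] c ≡ n * c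
  sum-const zero    c = refl
  sum-const (suc n) c = cong (c +_) (sum-const n c)

  sum-mono-≤ : {f g : Fin n → ℕ} → (∀ i → f i ≤ g i) → sum f ≤ sum g
  sum-mono-≤ {zero}  f≤g = z≤n
  sum-mono-≤ {suc n} f≤g = +-mono-≤ (f≤g zero) (sum-mono-≤ (f≤g ∘ suc))

  -- Both sides equal `u 0 + ... + u n`. It serves both for sums over a period and for sliding a
  -- window by one place.
  sum-shift : ∀ n (u : ℕ → ℕ) → ∑[ i < n ] u (suc (toℕ i)) + u 0 ≡ ∑[ i < n ] u (toℕ i) + u n
  sum-shift zero    u = refl
  sum-shift (suc n) u = begin
    u 1 + ∑[ i < n ] u (2 + toℕ i) + u 0          ≡⟨ cong (_+ u 0) (+-comm (u 1) _) ⟩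
    ∑[ i < n ] u (2 + toℕ i) + u 1 + u 0          ≡⟨ cong (_+ u 0) (sum-shift n (u ∘ suc)) ⟩
    ∑[ i < n ] u (suc (toℕ i)) + u (suc n) + u 0  ≡⟨ +-comm _ (u 0) ⟩
    u 0 + (∑[ i < n ] u (suc (toℕ i)) + u (suc n)) ≡⟨ +-assoc (u 0) _ (u (suc n)) ⟨
    u 0 + ∑[ i < n ] u (suc (toℕ i)) + u (suc n)  ∎
    where open ≡-Reasoning

  sum-periodic : ∀ n (u : ℕ → ℕ) → (∀ p → u (p + n) ≡ u p) →
    ∀ q → ∑[ i < n ] u (toℕ i + q) ≡ ∑[ i < n ] u (toℕ i)
  sum-periodic n u period zero    = sum-cong-≗ {n} (λ i → cong u (+-identityʳ (toℕ i)))
  sum-periodic n u period (suc q) = trans (+-cancelʳ-≡ (u q) _ _ (begin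
    ∑[ i < n ] u (toℕ i + suc q) + u q    ≡⟨ cong (_+ u q) (sum-cong-≗ {n} (λ i → cong u (+-suc (toℕ i) q))) ⟩
    ∑[ i < n ] u (suc (toℕ i) + q) + u q  ≡⟨ sum-shift n (λ p → u (p + q)) ⟩
    ∑[ i < n ] u (toℕ i + q) + u (n + q)  ≡⟨ cong (∑[ i < n ] u (toℕ i + q) +_) (trans (cong u (+-comm n q)) (period q)) ⟩
    ∑[ i < n ] u (toℕ i + q) + u q        ∎)) (sum-periodic n u period q)
    where open ≡-Reasoning

  injective⇒permutation : (σ : Fin n → Fin n) → Injective _≡_ _≡_ σ → Permutation n n
  injective⇒permutation {n} σ inj = permutation σ τ στ (λ x → inj (στ (σ x)))
    where
    preimage : ∀ {n} (σ : Fin n → Fin n) → Injective _≡_ _≡_ σ → ∀ y → ∃ λ x → σ x ≡ y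
    preimage {suc n} σ inj y with any? (λ x → σ x ≟F y)
    ... | yes found = found
    -- Pigeonhole: if `y` is missed, deleting it from the codomain leaves an injection into a
    -- smaller `Fin`.
    ... | no ¬found = ⊥-elim (1+n≰n (injective⇒≤ {f = λ x → punchOut (y≢σ x)}
                        (λ {x} {x′} → inj ∘ punchOut-injective (y≢σ x) (y≢σ x′))))
      where
      y≢σ : ∀ x → y ≢ σ x
      y≢σ x y≡σx = ¬found (x , sym y≡σx)
    τ : Fin n → Fin n
    τ y = proj₁ (preimage σ inj y)
    στ : ∀ y → σ (τ y) ≡ y
    στ y = proj₂ (preimage σ inj y)

  χ : Subset n → Fin n → ℕ
  χ A x = if lookup A x then 1 else 0

  χ≤1 : (A : Subset n) (x : Fin n) → χ A x ≤ 1
  χ≤1 A x with lookup A x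
  ... | true  = ≤-refl
  ... | false = z≤n

  χ+χ∁≡1 : (A : Subset n) (x : Fin n) → χ A x + χ (∁ A) x ≡ 1
  χ+χ∁≡1 (true ∷ A)  zero    = refl
  χ+χ∁≡1 (false ∷ A) zero    = refl
  χ+χ∁≡1 (_ ∷ A)     (suc x) = χ+χ∁≡1 A x

  sum-χ : (A : Subset n) → sum (χ A) ≡ ∣ A ∣
  sum-χ []          = refl
  sum-χ (true ∷ A)  = cong suc (sum-χ A)
  sum-χ (false ∷ A) = sum-χ A

  -- The inequality is strict exactly when `x` already lies in `S` and in `A`.
  ∣⁅x⁆∪S∩A∣≤χ+∣S∩A∣ : (A S : Subset n) (x : Fin n) → ∣ (⁅ x ⁆ ∪ S) ∩ A ∣ ≤ χ A x + ∣ S ∩ A ∣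
  ∣⁅x⁆∪S∩A∣≤χ+∣S∩A∣ (true ∷ A)  (true ∷ S)  zero rewrite ∪-identityˡ S = n≤1+n _
  ∣⁅x⁆∪S∩A∣≤χ+∣S∩A∣ (true ∷ A)  (false ∷ S) zero rewrite ∪-identityˡ S = ≤-refl
  ∣⁅x⁆∪S∩A∣≤χ+∣S∩A∣ (false ∷ A) (true ∷ S)  zero rewrite ∪-identityˡ S = ≤-refl
  ∣⁅x⁆∪S∩A∣≤χ+∣S∩A∣ (false ∷ A) (false ∷ S) zero rewrite ∪-identityˡ S = ≤-refl
  ∣⁅x⁆∪S∩A∣≤χ+∣S∩A∣ (true ∷ A)  (true ∷ S)  (suc x) =
    ≤-trans (s≤s (∣⁅x⁆∪S∩A∣≤χ+∣S∩A∣ A S x)) (≤-reflexive (sym (+-suc (χ A x) _)))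
  ∣⁅x⁆∪S∩A∣≤χ+∣S∩A∣ (true ∷ A)  (false ∷ S) (suc x) = ∣⁅x⁆∪S∩A∣≤χ+∣S∩A∣ A S x
  ∣⁅x⁆∪S∩A∣≤χ+∣S∩A∣ (false ∷ A) (true ∷ S)  (suc x) = ∣⁅x⁆∪S∩A∣≤χ+∣S∩A∣ A S x
  ∣⁅x⁆∪S∩A∣≤χ+∣S∩A∣ (false ∷ A) (false ∷ S) (suc x) = ∣⁅x⁆∪S∩A∣≤χ+∣S∩A∣ A S x

  -- With `g = id` this unfolds to `window`. The extra map `g` makes induction on `k` possible, the
  -- tail of `applyUpTo g` being an `applyUpTo (g ∘ suc)`.
  image : (ℕ → Fin n) → (ℕ → ℕ) → ℕ → Subset n
  image v g k = foldr (λ q S → ⁅ v q ⁆ ∪ S) ∅ (applyUpTo g k)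

  ∣image∩A∣≤sum-χ : (A : Subset n) (v : ℕ → Fin n) (g : ℕ → ℕ) (k : ℕ) →
    ∣ image v g k ∩ A ∣ ≤ ∑[ q < k ] χ A (v (g (toℕ q)))
  ∣image∩A∣≤sum-χ {n} A v g zero = ≤-reflexive (trans (cong ∣_∣ (∩-zeroˡ A)) (∣⊥∣≡0 n))
  ∣image∩A∣≤sum-χ A v g (suc k) =
    ≤-trans (∣⁅x⁆∪S∩A∣≤χ+∣S∩A∣ A _ (v (g 0))) (+-monoʳ-≤ (χ A (v (g 0))) (∣image∩A∣≤sum-χ A v (g ∘ suc) k))

  -- The upper bounds for A and for ∁ A add up to k, hence both are attained.
  ∣image∩A∣≡sum-χ : (A : Subset n) (v : ℕ → Fin n) (k : ℕ) → ∣ image v id k ∣ ≡ k →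
    ∣ image v id k ∩ A ∣ ≡ ∑[ q < k ] χ A (v (toℕ q))
  ∣image∩A∣≡sum-χ A v k ∣W∣≡k = ≤-antisym (∣image∩A∣≤sum-χ A v id k) (+-cancelʳ-≤ Σ∁A ΣA ∣ W ∩ A ∣ (begin
    ΣA + Σ∁A                   ≡⟨ ∑-distrib-+ {k} (λ q → χ A (v (toℕ q))) (λ q → χ (∁ A) (v (toℕ q))) ⟨
    ∑[ q < k ] (χ A (v (toℕ q)) + χ (∁ A) (v (toℕ q)))
                               ≡⟨ sum-cong-≗ {k} (λ q → χ+χ∁≡1 A (v (toℕ q))) ⟩
    ∑[ q < k ] 1               ≡⟨ sum-const k 1 ⟩
    k * 1                      ≡⟨ *-identityʳ k ⟩
    k                          ≡⟨ ∣W∣≡k ⟨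
    ∣ W ∣                      ≡⟨ ∣p∩q∣+∣p∩∁q∣≡∣p∣ W A ⟨
    ∣ W ∩ A ∣ + ∣ W ∩ ∁ A ∣    ≤⟨ +-monoʳ-≤ ∣ W ∩ A ∣ (∣image∩A∣≤sum-χ (∁ A) v id k) ⟩
    ∣ W ∩ A ∣ + Σ∁A            ∎))
    where
    open ≤-Reasoning
    W   = image v id k
    ΣA  = ∑[ q < k ] χ A (v (toℕ q))
    Σ∁A = ∑[ q < k ] χ (∁ A) (v (toℕ q))

  module _ (g : ℕ → ℕ) (j n : ℕ) (g≢j : ∀ p → p < n → g p ≢ j)
           (up : ∀ p → g (suc p) ≤ suc (g p)) (down : ∀ p → g p ≤ suc (g (suc p))) where

    -- Discrete intermediate values: a step from below `j` reaches at most `j`, and the value `j` is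
    -- excluded. `stays-above` is the mirror image.
    stays-below : g 0 < j → ∀ p → p < n → g p < j
    stays-below g0<j zero    _     = g0<j
    stays-below g0<j (suc p) 1+p<n =
      ≤∧≢⇒< (≤-trans (up p) (stays-below g0<j p (<⇒≤ 1+p<n))) (g≢j (suc p) 1+p<n)

    stays-above : j < g 0 → ∀ p → p < n → j < g p
    stays-above j<g0 zero    _     = j<g0
    stays-above j<g0 (suc p) 1+p<n =
      ≤∧≢⇒< (s≤s⁻¹ (≤-trans (stays-above j<g0 p (<⇒≤ 1+p<n)) (down p))) (g≢j (suc p) 1+p<n ∘ sym)

  avoiding-noHamTightCycle : ∀ k j m (A : Subset (suc m)) →
    k * ∣ A ∣ < suc j * suc m → j * suc m < k * ∣ A ∣ + suc m →
    ¬ HasHamTightCycle (avoiding k j A)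
  avoiding-noHamTightCycle k j m A k∣A∣<[1+j]n jn<k∣A∣+n (σ , σ-inj , edges) = conclude
    where
    N = suc m
    H = avoiding k j A
    -- The indicator of `A` along the cycle is extended periodically to all naturals, so that
    -- windows that wrap around are treated like the others; `g p` counts `A` in the window starting
    -- at `p`.
    u : ℕ → ℕ
    u p = χ A (σ (p mod N))
    g : ℕ → ℕ
    g p = ∑[ q < k ] u (p + toℕ q)

    -- Being an edge, the window has `k` elements, so no vertex is repeated and the sum of
    -- indicators is exact.
    g≡∣window∩A∣ : ∀ i → ∣ window k σ i ∩ A ∣ ≡ g (toℕ i)
    g≡∣window∩A∣ i = ∣image∩A∣≡sum-χ A (λ q → σ ((toℕ i + q) mod N)) k (uniform H (window k σ i) (edges i))

    g≢j-Fin : ∀ i → g (toℕ i) ≢ j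
    g≢j-Fin i g≡j with Equivalence.to T-not-≡ (proj₂ (Equivalence.to
                         (T-∧ {∣ window k σ i ∣ ≡ᵇ k}) (Equivalence.from T-≡ (edges i))))
    ... | ≢ᵇ = subst T ≢ᵇ (≡⇒≡ᵇ _ j (trans (g≡∣window∩A∣ i) g≡j))

    g≢j : ∀ p → p < N → g p ≢ j
    g≢j p p<n = subst (λ p → g p ≢ j) (toℕ-fromℕ< p<n) (g≢j-Fin (fromℕ< p<n))

    -- Moving the window one place drops position `p` and gains position `p + k`.
    slide : ∀ p → g (suc p) + u p ≡ g p + u (p + k)
    slide p = begin
      g (suc p) + u p
        ≡⟨ cong₂ _+_ (sum-cong-≗ {k} (λ q → cong u (sym (+-suc p (toℕ q))))) (cong u (sym (+-identityʳ p))) ⟩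
      ∑[ q < k ] u (p + suc (toℕ q)) + u (p + 0)
        ≡⟨ sum-shift k (λ q → u (p + q)) ⟩
      g p + u (p + k) ∎
      where open ≡-Reasoning

    up : ∀ p → g (suc p) ≤ suc (g p)
    up p = begin
      g (suc p)        ≤⟨ m≤m+n (g (suc p)) (u p) ⟩
      g (suc p) + u p  ≡⟨ slide p ⟩
      g p + u (p + k)  ≤⟨ +-monoʳ-≤ (g p) (χ≤1 A _) ⟩
      g p + 1          ≡⟨ +-comm (g p) 1 ⟩
      suc (g p)        ∎
      where open ≤-Reasoning

    down : ∀ p → g p ≤ suc (g (suc p))
    down p = begin
      g p              ≤⟨ m≤m+n (g p) (u (p + k)) ⟩
      g p + u (p + k)  ≡⟨ slide p ⟨
      g (suc p) + u p  ≤⟨ +-monoʳ-≤ (g (suc p)) (χ≤1 A _) ⟩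
      g (suc p) + 1    ≡⟨ +-comm (g (suc p)) 1 ⟩
      suc (g (suc p))  ∎
      where open ≤-Reasoning

    u-periodic : ∀ p → u (p + N) ≡ u p
    u-periodic p = cong (χ A ∘ σ) (toℕ-injective (trans (toℕ-fromℕ< (m%n<n (p + N) N))
      (trans ([m+n]%n≡m%n p N) (sym (toℕ-fromℕ< (m%n<n p N))))))

    toℕ-mod : ∀ (i : Fin N) → toℕ i mod N ≡ i
    toℕ-mod i = toℕ-injective (trans (toℕ-fromℕ< (m%n<n (toℕ i) N)) (m<n⇒m%n≡m (toℕ<n i)))

    sum-u : ∑[ i < N ] u (toℕ i) ≡ ∣ A ∣
    sum-u = begin
      ∑[ i < N ] u (toℕ i)   ≡⟨ sum-cong-≗ {N} (λ i → cong (χ A ∘ σ) (toℕ-mod i)) ⟩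
      ∑[ i < N ] χ A (σ i)   ≡⟨ sum-permute (χ A) (injective⇒permutation σ σ-inj) ⟨
      sum (χ A)              ≡⟨ sum-χ A ⟩
      ∣ A ∣                  ∎
      where open ≡-Reasoning

    -- Double counting: for each of the `k` offsets, the start runs over a full period and so meets
    -- `A` exactly `∣ A ∣` times.
    sum-g : ∑[ i < N ] g (toℕ i) ≡ k * ∣ A ∣
    sum-g = begin
      ∑[ i < N ] ∑[ q < k ] u (toℕ i + toℕ q)  ≡⟨ ∑-comm {N} {k} (λ i q → u (toℕ i + toℕ q)) ⟩
      ∑[ q < k ] ∑[ i < N ] u (toℕ i + toℕ q)
        ≡⟨ sum-cong-≗ {k} (λ q → trans (sum-periodic N u u-periodic (toℕ q)) sum-u) ⟩
      ∑[ q < k ] ∣ A ∣                         ≡⟨ sum-const k ∣ A ∣ ⟩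
      k * ∣ A ∣                                ∎
      where open ≡-Reasoning

    all-below : g 0 < j → k * ∣ A ∣ + N ≤ j * N
    all-below g0<j = begin
      k * ∣ A ∣ + N                          ≡⟨ cong₂ _+_ (sym sum-g) (sym (trans (sum-const N 1) (*-identityʳ N))) ⟩
      ∑[ i < N ] g (toℕ i) + ∑[ i < N ] 1    ≡⟨ ∑-distrib-+ {N} (λ i → g (toℕ i)) (λ _ → 1) ⟨
      ∑[ i < N ] (g (toℕ i) + 1)             ≤⟨ sum-mono-≤ {N} (λ i → subst (_≤ j) (+-comm 1 (g (toℕ i)))
                                                  (stays-below g j N g≢j up down g0<j (toℕ i) (toℕ<n i))) ⟩
      ∑[ i < N ] j                           ≡⟨ sum-const N j ⟩
      N * j                                  ≡⟨ *-comm N j ⟩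
      j * N                                  ∎
      where open ≤-Reasoning

    all-above : j < g 0 → suc j * N ≤ k * ∣ A ∣
    all-above j<g0 = begin
      suc j * N             ≡⟨ *-comm (suc j) N ⟩
      N * suc j             ≡⟨ sum-const N (suc j) ⟨
      ∑[ i < N ] (suc j)    ≤⟨ sum-mono-≤ {N} (λ i → stays-above g j N g≢j up down j<g0 (toℕ i) (toℕ<n i)) ⟩
      ∑[ i < N ] g (toℕ i)  ≡⟨ sum-g ⟩
      k * ∣ A ∣             ∎
      where open ≤-Reasoning

    conclude : ⊥
    conclude with <-cmp (g 0) j
    ... | tri< g0<j _ _ = <⇒≱ jn<k∣A∣+n (all-below g0<j)
    ... | tri≈ _ g0≡j _ = g≢j 0 (s≤s z≤n) g0≡j
    ... | tri> _ _ j<g0 = <⇒≱ k∣A∣<[1+j]n (all-above j<g0)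

-- The extremal hypergraph and its minimum degree.

module Extremal where

  open Binomials
  open Counting
  open TightCycles
  open import Data.Nat hiding (_/_; _%_)
  open import Data.Nat.Properties
  open import Data.Nat.Combinatorics
  open import Data.Nat.DivMod using (_/_; _%_; m/n*n≤m; m≡m%n+[m/n]*n; m%n<n)
  open import Data.Nat.Tactic.RingSolver using (solve-∀)
  open import Data.Bool using (true; false)
  open import Data.Fin.Subset using (Subset; ∣_∣; ∁)
  open import Data.Fin.Subset.Properties using (∣∁p∣≡n∸∣p∣)
  open import Data.Vec using ([]; _∷_)
  open import Data.Product using (_,_)
  open import Relation.Nullary using (¬_; yes; no; contradiction)
  open import Relation.Binary.PropositionalEquality

  ^-distribʳ-* : ∀ o m n → (m * n) ^ o ≡ m ^ o * n ^ o
  ^-distribʳ-* zero    m n = refl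
  ^-distribʳ-* (suc o) m n = trans (cong (m * n *_) (^-distribʳ-* o m n)) ([m*n]*[o*p]≡[m*o]*[n*p] m n (m ^ o) (n ^ o))

  [aCi]*i!*s^i≤[cN]^i : ∀ {a s c N} i → a * s ≤ c * N → (a C i) * i ! * s ^ i ≤ c ^ i * N ^ i
  [aCi]*i!*s^i≤[cN]^i {a} {s} {c} {N} i as≤cN = begin
    (a C i) * i ! * s ^ i  ≤⟨ *-monoˡ-≤ (s ^ i) (nCk*k!≤n^k a i) ⟩
    a ^ i * s ^ i          ≡⟨ ^-distribʳ-* i a s ⟨
    (a * s) ^ i            ≤⟨ ^-monoˡ-≤ i as≤cN ⟩
    (c * N) ^ i            ≡⟨ ^-distribʳ-* i c N ⟩
    c ^ i * N ^ i          ∎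
    where open ≤-Reasoning

  -- The numerator of the fraction in constC t, with f = ⌊ t /2⌋ and c = ⌈ t /2⌉.
  peak : ℕ → ℕ → ℕ
  peak f c = ((f + c) C f) * c ^ c * suc f ^ f

  -- Divided through, `(a C i) * (b C l)` is at most `N ^ t / t !` times the probability of `i`
  -- successes in `t` trials with success probability `c / s`, since `suc f / s` is the
  -- complementary probability. `binomial-mode` then replaces `i` by the mode `c`.
  choose-product-bound : ∀ {a b N} f c i l → i + l ≡ f + c →
    a * suc (f + c) ≤ c * N → b * suc (f + c) ≤ suc f * N →
    (a C i) * (b C l) * (f + c) ! * suc (f + c) ^ (f + c) ≤ peak f c * N ^ (f + c)
  choose-product-bound {a} {b} {N} f c i l i+l≡t as≤cN bs≤gN = *-cancelʳ-≤ _ _ (i ! * l !) (begin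
    (a C i) * (b C l) * t ! * s ^ t * (i ! * l !)
      ≡⟨ cong₂ (λ y z → (a C i) * (b C l) * y * z * (i ! * l !))
           (sym ([k+l]Ck*k!*l!≡[k+l]! f c)) (split s) ⟩
    (a C i) * (b C l) * (T * (f ! * c !)) * (s ^ i * s ^ l) * (i ! * l !)
      ≡⟨ regroup (a C i) (b C l) T (f !) (c !) (s ^ i) (s ^ l) (i !) (l !) ⟩
    T * (c ! * f !) * ((a C i) * i ! * s ^ i * ((b C l) * l ! * s ^ l))
      ≤⟨ *-monoʳ-≤ (T * (c ! * f !))
           (*-mono-≤ ([aCi]*i!*s^i≤[cN]^i i as≤cN) ([aCi]*i!*s^i≤[cN]^i l bs≤gN)) ⟩
    T * (c ! * f !) * (c ^ i * N ^ i * (g ^ l * N ^ l))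
      ≡⟨ regroup₂ T (c !) (f !) (c ^ i) (N ^ i) (g ^ l) (N ^ l) ⟩
    c ! * f ! * (c ^ i * g ^ l) * (T * (N ^ i * N ^ l))
      ≤⟨ *-monoˡ-≤ _ (binomial-mode c f i l (trans i+l≡t (+-comm f c))) ⟩
    i ! * l ! * (c ^ c * g ^ f) * (T * (N ^ i * N ^ l))
      ≡⟨ regroup₃ (i !) (l !) (c ^ c) (g ^ f) T (N ^ i * N ^ l) ⟩
    T * c ^ c * g ^ f * (N ^ i * N ^ l) * (i ! * l !)
      ≡⟨ cong (λ z → peak f c * z * (i ! * l !)) (sym (split N)) ⟩
    peak f c * N ^ t * (i ! * l !) ∎)
    where
    open ≤-Reasoning
    t = f + c
    s = suc t
    g = suc f
    T = t C f
    instance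
      i!*l!≢0 : NonZero (i ! * l !)
      i!*l!≢0 = i !* l !≢0
    split : ∀ x → x ^ t ≡ x ^ i * x ^ l
    split x = trans (cong (x ^_) (sym i+l≡t)) (^-distribˡ-+-* x i l)
    regroup : ∀ A B T F C x y I L → A * B * (T * (F * C)) * (x * y) * (I * L) ≡ T * (C * F) * (A * I * x * (B * L * y))
    regroup = solve-∀
    regroup₂ : ∀ T C F x M y N → T * (C * F) * (x * M * (y * N)) ≡ C * F * (x * y) * (T * (M * N))
    regroup₂ = solve-∀
    regroup₃ : ∀ I L x y T N → I * L * (x * y) * (T * N) ≡ T * x * y * N * (I * L)
    regroup₃ = solve-∀

  initial : ∀ n → ℕ → Subset n
  initial zero    a       = []
  initial (suc n) zero    = false ∷ initial n zero
  initial (suc n) (suc a) = true ∷ initial n a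

  ∣initial∣ : ∀ n a → a ≤ n → ∣ initial n a ∣ ≡ a
  ∣initial∣ zero    zero    _         = refl
  ∣initial∣ (suc n) zero    _         = ∣initial∣ n zero z≤n
  ∣initial∣ (suc n) (suc a) (s≤s a≤n) = cong suc (∣initial∣ n a a≤n)

  m<[m/n]*n+n : ∀ m n .{{_ : NonZero n}} → m < (m / n) * n + n
  m<[m/n]*n+n m n = begin-strict
    m                    ≡⟨ m≡m%n+[m/n]*n m n ⟩
    m % n + (m / n) * n  <⟨ +-monoˡ-< _ (m%n<n m n) ⟩
    n + (m / n) * n      ≡⟨ +-comm n _ ⟩
    (m / n) * n + n      ∎
    where open ≤-Reasoning

  -- Writing the number of vertices as `m + k` makes the complement of a `d`-set have `m + t`
  -- elements without subtraction, and positivity of `m` gives `k < n`.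
  module Construction (d f c m : ℕ) .{{_ : NonZero m}} where

    t s g k n j a : ℕ
    t = f + c
    s = suc t
    g = suc f
    k = d + t
    n = m + k
    j = (k * c) / s
    a = (n * c) / s

    as≤nc : a * s ≤ n * c
    as≤nc = m/n*n≤m (n * c) s

    nc≤as+s : n * c ≤ a * s + s
    nc≤as+s = <⇒≤ (m<[m/n]*n+n (n * c) s)

    a≤n : a ≤ n
    a≤n = *-cancelʳ-≤ a n s (≤-trans as≤nc (*-monoʳ-≤ n (m≤n⇒m≤1+n (m≤n+m c f))))

    A : Subset n
    A = initial n a

    ∣A∣≡a : ∣ A ∣ ≡ a
    ∣A∣≡a = ∣initial∣ n a a≤n

    ∣A∣s≤c[n+s] : ∣ A ∣ * s ≤ c * (n + s)
    ∣A∣s≤c[n+s] = begin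
      ∣ A ∣ * s    ≡⟨ cong (_* s) ∣A∣≡a ⟩
      a * s        ≤⟨ as≤nc ⟩
      n * c        ≡⟨ *-comm n c ⟩
      c * n        ≤⟨ *-monoʳ-≤ c (m≤m+n n s) ⟩
      c * (n + s)  ∎
      where open ≤-Reasoning

    -- Rounding `a` down may enlarge the complement beyond `g * n / s`; replacing `n` by `n + s`
    -- pays for this. The bound on `∣ A ∣` is weakened in the same way, so that both fit one `N`.
    ∣∁A∣s≤g[n+s] : ∣ ∁ A ∣ * s ≤ g * (n + s)
    ∣∁A∣s≤g[n+s] = begin
      ∣ ∁ A ∣ * s     ≡⟨ cong (_* s) (trans (∣∁p∣≡n∸∣p∣ A) (cong (n ∸_) ∣A∣≡a)) ⟩
      (n ∸ a) * s     ≡⟨ *-distribʳ-∸ s n a ⟩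
      n * s ∸ a * s   ≤⟨ m≤n+o⇒m∸n≤o (n * s) (a * s) ns≤as+[s+gn] ⟩
      s + g * n       ≤⟨ +-monoˡ-≤ (g * n) (m≤n*m s g) ⟩
      g * s + g * n   ≡⟨ +-comm (g * s) (g * n) ⟩
      g * n + g * s   ≡⟨ *-distribˡ-+ g n s ⟨
      g * (n + s)     ∎
      where
      open ≤-Reasoning
      expand : ∀ n f c → n * suc (f + c) ≡ n * c + suc f * n
      expand = solve-∀
      ns≤as+[s+gn] : n * s ≤ a * s + (s + g * n)
      ns≤as+[s+gn] = begin
        n * s                  ≡⟨ expand n f c ⟩
        n * c + g * n          ≤⟨ +-monoˡ-≤ (g * n) nc≤as+s ⟩
        a * s + s + g * n      ≡⟨ +-assoc (a * s) s (g * n) ⟩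
        a * s + (s + g * n)    ∎

    H : KGraph k n
    H = avoiding k j A

    -- The average `k * a / n` is at most `k * c / s`, whose integer part is `j`.
    k∣A∣<[1+j]n : k * ∣ A ∣ < suc j * n
    k∣A∣<[1+j]n = *-cancelʳ-< s _ _ (begin-strict
      k * ∣ A ∣ * s      ≡⟨ cong (λ z → k * z * s) ∣A∣≡a ⟩
      k * a * s          ≡⟨ *-assoc k a s ⟩
      k * (a * s)        ≤⟨ *-monoʳ-≤ k as≤nc ⟩
      k * (n * c)        ≡⟨ swap k n c ⟩
      k * c * n          <⟨ *-monoˡ-< n (m<[m/n]*n+n (k * c) s) ⟩
      (j * s + s) * n    ≡⟨ collect j s n ⟩
      suc j * n * s      ∎)
      where
      open ≤-Reasoning
      instance
        n≢0 : NonZero n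
        n≢0 = >-nonZero (≤-trans (>-nonZero⁻¹ m) (m≤m+n m k))
      swap : ∀ k n c → k * (n * c) ≡ k * c * n
      swap = solve-∀
      collect : ∀ j s n → (j * s + s) * n ≡ suc j * n * s
      collect = solve-∀

    -- Rounding `a` down lowers the average by at most `k / n`, which is less than one, so it stays
    -- above `j - 1`.
    jn<k∣A∣+n : j * n < k * ∣ A ∣ + n
    jn<k∣A∣+n = *-cancelʳ-< s _ _ (begin-strict
      j * n * s          ≡⟨ swap j n s ⟩
      j * s * n          ≤⟨ *-monoˡ-≤ n (m/n*n≤m (k * c) s) ⟩
      k * c * n          ≡⟨ swap₂ k c n ⟩
      k * (n * c)        ≤⟨ *-monoʳ-≤ k nc≤as+s ⟩
      k * (a * s + s)    ≡⟨ collect k a s ⟩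
      (k * a + k) * s    <⟨ *-monoˡ-< s (+-monoʳ-< (k * a) k<n) ⟩
      (k * a + n) * s    ≡⟨ cong (λ z → (k * z + n) * s) ∣A∣≡a ⟨
      (k * ∣ A ∣ + n) * s ∎)
      where
      open ≤-Reasoning
      k<n : k < n
      k<n = +-monoˡ-≤ k (>-nonZero⁻¹ m)
      swap : ∀ j n s → j * n * s ≡ j * s * n
      swap = solve-∀
      swap₂ : ∀ k c n → k * c * n ≡ k * (n * c)
      swap₂ = solve-∀
      collect : ∀ k a s → k * (a * s + s) ≡ (k * a + k) * s
      collect = solve-∀

    H-noHamTightCycle : ¬ HasHamTightCycle H
    H-noHamTightCycle = go n A k∣A∣<[1+j]n jn<k∣A∣+n
      where
      -- The number of vertices is generalised so that it can be matched as a successor, which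
      -- `m + k` is not syntactically.
      go : ∀ n (A : Subset n) → k * ∣ A ∣ < suc j * n → j * n < k * ∣ A ∣ + n →
           ¬ HasHamTightCycle (avoiding k j A)
      go zero    A p q = contradiction (≤-trans p (≤-reflexive (*-zeroʳ (suc j)))) λ ()
      go (suc n) A p q = avoiding-noHamTightCycle k j n A p q

    -- `K / D` is the fraction in `constC t`, and `r` is the offset for which `n + s` equals
    -- `m + r`.
    D K r : ℕ
    D = s ^ t
    K = peak f c
    r = k + s

    private instance
      D≢0 : NonZero D
      D≢0 = m^n≢0 s t

    -- For positive `q` this says that the degree is at least `(1 - K / D - 1 / q) * (n C t)`, with
    -- denominators cleared. After multiplication by `t !`, all binomials are compared with `m ^ t`
    -- or `(m + r) ^ t`.
    deg-H : ∀ q → (D + K) * q * growthConst r t ≤ m → (S : Subset n) → ∣ S ∣ ≡ d →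
      D * q * (n C t) ≤ D * q * deg H S + (K * q * (n C t) + D * (n C t))
    deg-H q ER≤m S ∣S∣≡d with deg-avoiding d t j A S ∣S∣≡d
    ... | i , l , i+l≡t , C′≤deg+M = +-cancelʳ-≤ (D * q * M) _ _ (begin
      D * q * B + D * q * M                                ≤⟨ *-cancelʳ-≤ _ _ (t !) scaled ⟩
      D * q * B′ + (K * q * B + D * B)                     ≤⟨ +-monoˡ-≤ _ (*-monoʳ-≤ (D * q) C′≤deg+M) ⟩
      D * q * (deg H S + M) + (K * q * B + D * B)          ≡⟨ regroup (D * q) (deg H S) M _ ⟩
      D * q * deg H S + (K * q * B + D * B) + D * q * M    ∎)
      where
      open ≤-Reasoning
      instance
        t!≢0 : NonZero (t !)
        t!≢0 = t !≢0
      B  = n C t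
      B′ = ∣ ∁ S ∣ C t
      M  = (∣ A ∣ C i) * (∣ ∁ A ∣ C l)
      Y  = m ^ t
      Z  = (m + r) ^ t
      E  = (D + K) * q
      regroup : ∀ x y z w → x * (y + z) + w ≡ x * y + w + x * z
      regroup = solve-∀
      m+t≡∣∁S∣ : m + t ≡ ∣ ∁ S ∣
      m+t≡∣∁S∣ = sym (trans (∣∁p∣≡n∸∣p∣ S) (trans (cong₂ _∸_ (rotate m d t) ∣S∣≡d) (m+n∸m≡n d (m + t))))
        where
        rotate : ∀ m d t → m + (d + t) ≡ d + (m + t)
        rotate = solve-∀
      n+s≡m+r : n + s ≡ m + r
      n+s≡m+r = +-assoc m k s
      B≤Z : B * t ! ≤ Z
      B≤Z = ≤-trans (nCk*k!≤n^k n t) (^-monoˡ-≤ t (≤-trans (m≤m+n n s) (≤-reflexive n+s≡m+r)))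
      Y≤B′ : Y ≤ B′ * t !
      Y≤B′ = subst (λ z → Y ≤ (z C t) * t !) m+t≡∣∁S∣ (m^t≤[m+t]Ct*t! m t)
      Y≤B : Y ≤ B * t !
      Y≤B = ≤-trans (m^t≤[m+t]Ct*t! m t) (*-monoˡ-≤ (t !) (C-monoˡ-≤ t (+-monoʳ-≤ m (m≤n+m t d))))
      M≤KZ : M * t ! * D ≤ K * Z
      M≤KZ = subst (λ z → M * t ! * D ≤ K * z ^ t) n+s≡m+r
               (choose-product-bound f c i l i+l≡t ∣A∣s≤c[n+s] ∣∁A∣s≤g[n+s])
      scaled : (D * q * B + D * q * M) * t ! ≤ (D * q * B′ + (K * q * B + D * B)) * t !
      scaled = begin
        (D * q * B + D * q * M) * t !            ≡⟨ expand D q B M (t !) ⟩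
        D * q * (B * t !) + M * t ! * D * q      ≤⟨ +-mono-≤ (*-monoʳ-≤ (D * q) B≤Z) (*-monoˡ-≤ q M≤KZ) ⟩
        D * q * Z + K * Z * q                    ≡⟨ collect D q K Z ⟩
        E * Z                                    ≤⟨ E*[m+r]^t≤[E+1]*m^t E r t m ER≤m ⟩
        -- The single surplus `Y` is enlarged to `D * Y`, so that dividing by `D * q` leaves the
        -- error term `1 / q`.
        Y + E * Y                                ≤⟨ +-monoˡ-≤ (E * Y) (m≤n*m Y D) ⟩
        D * Y + E * Y                            ≡⟨ expand₂ D K q Y ⟩
        D * q * Y + (K * q * Y + D * Y)
          ≤⟨ +-mono-≤ (*-monoʳ-≤ (D * q) Y≤B′) (+-mono-≤ (*-monoʳ-≤ (K * q) Y≤B) (*-monoʳ-≤ D Y≤B)) ⟩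
        D * q * (B′ * t !) + (K * q * (B * t !) + D * (B * t !)) ≡⟨ collect₂ D K q B B′ (t !) ⟩
        (D * q * B′ + (K * q * B + D * B)) * t ! ∎
        where
        expand : ∀ D q B M x → (D * q * B + D * q * M) * x ≡ D * q * (B * x) + M * x * D * q
        expand = solve-∀
        collect : ∀ D q K Z → D * q * Z + K * Z * q ≡ (D + K) * q * Z
        collect = solve-∀
        expand₂ : ∀ D K q Y → D * Y + (D + K) * q * Y ≡ D * q * Y + (K * q * Y + D * Y)
        expand₂ = solve-∀
        collect₂ : ∀ D K q B B′ x →
          D * q * (B′ * x) + (K * q * (B * x) + D * (B * x)) ≡ (D * q * B′ + (K * q * B + D * B)) * x
        collect₂ = solve-∀

    -- If `h` violated the bound, a degree of `H` below `h` would violate it too, contrary to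
    -- `deg-H`. Hence `H` would have minimum degree at least `h` and, by `ham`, a Hamilton cycle.
    HamProp-bound : ∀ q → (D + K) * q * growthConst r t ≤ m → ∀ h → HamProp d k n h →
      D * q * (n C t) ≤ D * q * h + (K * q * (n C t) + D * (n C t))
    HamProp-bound q ER≤m h ham with D * q * (n C t) ≤? D * q * h + (K * q * (n C t) + D * (n C t))
    ... | yes bound = bound
    ... | no ¬bound = contradiction (ham H mindeg) H-noHamTightCycle
      where
      mindeg : MinDegGeq d H h
      mindeg S ∣S∣≡d with h ≤? deg H S
      ... | yes h≤deg = h≤deg
      ... | no  h≰deg = contradiction
        (≤-trans (deg-H q ER≤m S ∣S∣≡d) (+-monoˡ-≤ _ (*-monoʳ-≤ (D * q) (≰⇒≥ h≰deg)))) ¬bound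

-- From the inequality over the naturals to the rational bound.

module Rationals where

  open Binomials
  open Extremal
  open import Data.Nat as ℕ using (ℕ; suc; NonZero)
  import Data.Nat.Properties as ℕ
  open import Data.Nat.Combinatorics using (_C_)
  open import Data.Product using (Σ; _,_)
  open import Data.Integer as ℤ using (+_; +[1+_])
  import Data.Integer.Properties as ℤ
  open import Data.Integer.Tactic.RingSolver using (solve-∀)
  open import Data.Rational using (ℚ; mkℚ; 1ℚ; toℚᵘ; Positive; ↧ₙ_; _-_; _*_; _/_) renaming (_≤_ to _≤ℚ_)
  import Data.Rational as ℚ
  import Data.Rational.Properties as ℚ
  import Data.Rational.Unnormalised as ℚᵘ
  import Data.Rational.Unnormalised.Properties as ℚᵘ
  open import Relation.Binary.PropositionalEquality

  clear-denominators : ∀ K D .{{_ : NonZero D}} (ε : ℚ) → Positive ε → ∀ B h →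
    D ℕ.* ↧ₙ ε ℕ.* B ℕ.≤ D ℕ.* ↧ₙ ε ℕ.* h ℕ.+ (K ℕ.* ↧ₙ ε ℕ.* B ℕ.+ D ℕ.* B) →
    (1ℚ - (+ K) / D - ε) * ℕtoℚ B ≤ℚ ℕtoℚ h
  clear-denominators K D@(suc D-1) ε@(mkℚ +[1+ p ] q-1 _) _ B h bound =
    ℚ.toℚᵘ-cancel-≤ (ℚᵘ.≤-respˡ-≃ (ℚᵘ.≃-sym lhs) (ℚᵘ.≤-respʳ-≃ (ℚᵘ.≃-sym (ℚ.toℚᵘ-fromℚᵘ h′)) (ℚᵘ.*≤* goal)))
    where
    q = suc q-1
    P = suc p
    x′ = ℚᵘ.mkℚᵘ (+ K) D-1
    B′ = ℚᵘ.mkℚᵘ (+ B) 0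
    h′ = ℚᵘ.mkℚᵘ (+ h) 0
    ε′ = ℚᵘ.mkℚᵘ +[1+ p ] q-1
    lhs′ = ((ℚᵘ.1ℚᵘ ℚᵘ.+ ℚᵘ.- x′) ℚᵘ.+ ℚᵘ.- ε′) ℚᵘ.* B′
    toℚᵘ-homo-minus : ∀ x y → toℚᵘ (x - y) ℚᵘ.≃ toℚᵘ x ℚᵘ.+ ℚᵘ.- toℚᵘ y
    toℚᵘ-homo-minus x y = ℚᵘ.≃-trans (ℚ.toℚᵘ-homo-+ x (ℚ.- y)) (ℚᵘ.+-congʳ (toℚᵘ x) (ℚ.toℚᵘ-homo‿- y))
    lhs : toℚᵘ ((1ℚ - (+ K) / D - ε) * ℕtoℚ B) ℚᵘ.≃ lhs′
    lhs = ℚᵘ.≃-trans (ℚ.toℚᵘ-homo-* (1ℚ - (+ K) / D - ε) (ℕtoℚ B))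
      (ℚᵘ.*-cong
        (ℚᵘ.≃-trans (toℚᵘ-homo-minus (1ℚ - (+ K) / D) ε)
          (ℚᵘ.+-congˡ (ℚᵘ.- ε′) (ℚᵘ.≃-trans (toℚᵘ-homo-minus 1ℚ ((+ K) / D))
            (ℚᵘ.+-congʳ ℚᵘ.1ℚᵘ (ℚᵘ.-‿cong (ℚ.toℚᵘ-fromℚᵘ x′))))))
        (ℚ.toℚᵘ-fromℚᵘ B′))
    -- With `ε = P / q` and `P ≥ 1`, the error `1 / q` is enlarged to `ε`.
    bound′ : D ℕ.* q ℕ.* B ℕ.≤ D ℕ.* q ℕ.* h ℕ.+ (K ℕ.* q ℕ.* B ℕ.+ P ℕ.* D ℕ.* B)
    bound′ = ℕ.≤-trans bound (ℕ.+-monoʳ-≤ (D ℕ.* q ℕ.* h) (ℕ.+-monoʳ-≤ (K ℕ.* q ℕ.* B) (ℕ.*-monoˡ-≤ B (ℕ.m≤n*m D P))))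
    cast* : ∀ a b c → + (a ℕ.* b ℕ.* c) ≡ + a ℤ.* + b ℤ.* + c
    cast* a b c = trans (ℤ.pos-* (a ℕ.* b) c) (cong (ℤ._* + c) (ℤ.pos-* a b))
    boundℤ : + D ℤ.* + q ℤ.* + B ℤ.≤ + D ℤ.* + q ℤ.* + h ℤ.+ (+ K ℤ.* + q ℤ.* + B ℤ.+ + P ℤ.* + D ℤ.* + B)
    boundℤ = subst₂ ℤ._≤_ (cast* D q B)
      (trans (ℤ.pos-+ (D ℕ.* q ℕ.* h) _) (cong₂ ℤ._+_ (cast* D q h)
        (trans (ℤ.pos-+ (K ℕ.* q ℕ.* B) _) (cong₂ ℤ._+_ (cast* K q B) (cast* P D B)))))
      (ℤ.+≤+ bound′)
    -- The difference of the two sides of `boundℤ` is the difference of the cross products in the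
    -- goal; the factors `+ 1` reproduce the shape to which unnormalised rational arithmetic
    -- computes.
    identity : ∀ D q B h K P → D ℤ.* q ℤ.* h ℤ.+ (K ℤ.* q ℤ.* B ℤ.+ P ℤ.* D ℤ.* B) ℤ.- D ℤ.* q ℤ.* B ≡
      h ℤ.* (D ℤ.* q) ℤ.- ((+ 1 ℤ.* D ℤ.+ ℤ.- K ℤ.* + 1) ℤ.* q ℤ.+ ℤ.- P ℤ.* D) ℤ.* B ℤ.* + 1
    identity = solve-∀
    goal′ : ((+ 1 ℤ.* + D ℤ.+ ℤ.- + K ℤ.* + 1) ℤ.* + q ℤ.+ ℤ.- + P ℤ.* + D) ℤ.* + B ℤ.* + 1 ℤ.≤ + h ℤ.* (+ D ℤ.* + q)
    goal′ = ℤ.0≤i-j⇒j≤i (subst (+ 0 ℤ.≤_) (identity (+ D) (+ q) (+ B) (+ h) (+ K) (+ P)) (ℤ.i≤j⇒0≤j-i boundℤ))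
    denominator : + (1 ℕ.* D) ≡ + D
    denominator = cong +_ (ℕ.*-identityˡ D)
    goal : ℚᵘ.↥ lhs′ ℤ.* ℚᵘ.↧ h′ ℤ.≤ ℚᵘ.↥ h′ ℤ.* ℚᵘ.↧ lhs′
    goal = subst₂ ℤ._≤_
      (cong (λ z → ((+ 1 ℤ.* + D ℤ.+ ℤ.- + K ℤ.* + 1) ℤ.* + q ℤ.+ ℤ.- + P ℤ.* z) ℤ.* + B ℤ.* + 1) (sym denominator))
      (cong (+ h ℤ.*_) (trans (sym (ℤ.pos-* D q))
        (cong +_ (trans (cong (ℕ._* q) (sym (ℕ.*-identityˡ D))) (sym (ℕ.*-identityʳ (1 ℕ.* D ℕ.* q)))))))
      goal′

  constC≡1-peak : ∀ t → constC t ≡ 1ℚ - ((+ peak ℕ.⌊ t /2⌋ ℕ.⌈ t /2⌉) / (suc t ℕ.^ t)) {{ℕ.m^n≢0 (suc t) t}}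
  constC≡1-peak t = cong (λ K → 1ℚ - ((+ K) / (suc t ℕ.^ t)) {{ℕ.m^n≢0 (suc t) t}})
    (cong₂ (λ t g → (t C f) ℕ.* c ℕ.^ c ℕ.* g ℕ.^ f) (sym (ℕ.⌊n/2⌋+⌈n/2⌉≡n t)) (ℕ.+-comm f 1))
    where
    f = ℕ.⌊ t /2⌋
    c = ℕ.⌈ t /2⌉

  -- The bound holds for every split `t = f + c`. Keeping `f`, `c` and `t` as variables lets the
  -- equation be matched with `refl`; the halves of `t` are inserted afterwards.
  HamProp-peak-threshold : ∀ d f c t → f ℕ.+ c ≡ t → (ε : ℚ) → Positive ε →
    Σ ℕ λ N → ∀ n h → N ℕ.≤ n → HamProp d (d ℕ.+ t) n h →
      (1ℚ - ((+ peak f c) / (suc t ℕ.^ t)) {{ℕ.m^n≢0 (suc t) t}} - ε) * ℕtoℚ (n C t) ≤ℚ ℕtoℚ h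
  -- For `n` beyond `k + suc M` the remainder `m` is positive and at least `M`, the size that
  -- `HamProp-bound` asks for when `q` is the denominator of `ε`.
  HamProp-peak-threshold d f c t refl ε ε>0 = k ℕ.+ suc M , λ n h N≤n ham → bound n h (ℕ.m≤n⇒∃[o]m+o≡n N≤n) ham
    where
    instance
      D≢0 : NonZero (suc t ℕ.^ t)
      D≢0 = ℕ.m^n≢0 (suc t) t
    k = d ℕ.+ t
    M = (suc t ℕ.^ t ℕ.+ peak f c) ℕ.* ↧ₙ ε ℕ.* growthConst (k ℕ.+ suc t) t
    bound : ∀ n h → (Σ ℕ λ o → k ℕ.+ suc M ℕ.+ o ≡ n) → HamProp d k n h →
      (1ℚ - (+ peak f c) / (suc t ℕ.^ t) - ε) * ℕtoℚ (n C t) ≤ℚ ℕtoℚ h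
    bound n h (o , k+1+M+o≡n) ham =
      subst (λ n → HamProp d k n h → (1ℚ - (+ peak f c) / (suc t ℕ.^ t) - ε) * ℕtoℚ (n C t) ≤ℚ ℕtoℚ h)
        (trans (ℕ.+-comm m k) (trans (sym (ℕ.+-assoc k (suc M) o)) k+1+M+o≡n))
        (λ ham → clear-denominators (peak f c) (suc t ℕ.^ t) ε ε>0 _ h
          (Construction.HamProp-bound d f c m (↧ₙ ε) (ℕ.m≤n⇒m≤1+n (ℕ.m≤m+n M o)) h ham))
        ham
      where m = suc M ℕ.+ o

  HamProp-threshold : ∀ d t (ε : ℚ) → Positive ε →
    Σ ℕ λ N → ∀ n h → N ℕ.≤ n → HamProp d (d ℕ.+ t) n h → (constC t - ε) * ℕtoℚ (n C t) ≤ℚ ℕtoℚ h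
  HamProp-threshold d t ε ε>0 rewrite constC≡1-peak t =
    HamProp-peak-threshold d ℕ.⌊ t /2⌋ ℕ.⌈ t /2⌉ t (ℕ.⌊n/2⌋+⌈n/2⌉≡n t) ε ε>0

-- The asymptotic lower bound for the tight Hamilton cycle threshold.

open import Data.Nat using (ℕ; _≤_; _∸_)
open import Data.Nat.Properties using (≤-trans; m+[n∸m]≡n; m∸n≤m)
open import Data.Nat.Combinatorics using (_C_)
open import Data.Product using (Σ; _,_)
open import Data.Rational using (ℚ; Positive; _-_; _*_) renaming (_≤_ to _≤ℚ_)
open import Relation.Binary.PropositionalEquality using (subst; sym)
open Rationals using (HamProp-threshold)

theorem1p4 : (k d : ℕ) → 2 ≤ k → 1 ≤ d → d ≤ k ∸ 1 →
    (ε : ℚ) → Positive ε →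
    Σ ℕ λ N → ∀ (n h : ℕ) → N ≤ n → IsHd d k n h →
    (constC (k ∸ d) - ε) * ℕtoℚ (n C (k ∸ d)) ≤ℚ ℕtoℚ h
theorem1p4 k d _ _ d≤k∸1 ε ε>0 with HamProp-threshold d (k ∸ d) ε ε>0
-- The bound holds for any `h` with the Hamilton property, in particular for the least one; `d ≤ k`
-- identifies `d + (k ∸ d)` with `k`.
... | N , bound = N , λ n h N≤n (ham , _) →
  bound n h N≤n (subst (λ k → HamProp d k n h) (sym (m+[n∸m]≡n (≤-trans d≤k∸1 (m∸n≤m k 1)))) ham)
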